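{- Let $G=(G_1,v_1,e_1)\Delta(G_2,v_2,e_2)$ be a Hajós join of two hypergraphs $G_1$ and $G_2$, and let $k\ge2$ be an integer. Then: (a) if both $G_1$ and $G_2$ are $(k+1)$-critical, then $G$ is $(k+1)$-critical; (b) if $G$ is $(k+1)$-critical and $k\ge3$, then both $G_1$ and $G_2$ are $(k+1)$-critical.
   Context: A hypergraph is a pair $G=(V,E)$ of finite sets with $E\subseteq 2^V$ and $|e|\ge2$ for all $e\in E$. A coloring requires every edge to contain two vertices of different colors; $\chi$ is the chromatic number. $G$ is $(k+1)$-critical if $\chi(G)=k+1$ but $\chi(H)\le k$ for every proper subhypergraph $H$. Hajós join $(G_1,v_1,e_1)\Delta(G_2,v_2,e_2)$: for vertex-disjoint hypergraphs $G_1,G_2$, $e_i\in E(G_i)$, $v_i\in e_i$, delete $e_1,e_2$, identify $v_1,v_2$ into a new vertex $v^*$, and add a new edge $e^*$ equal either to $(e_1\cup e_2)\setminus\{v_1,v_2\}$ or to $((e_1\cup e_2)\setminus\{v_1,v_2\})\cup\{v^*\}$. -}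

module Defs where

open import Data.Bool using (if_then_else_)
open import Data.Fin using (Fin)
open import Data.Fin.Subset
  using (Subset; _∈_; _∉_; _⊆_; _∪_; _∩_; _-_; ⁅_⁆; ∣_∣; Empty)
open import Data.Fin.Subset.Properties using (_∈?_)
open import Data.Nat using (ℕ; suc; _≤_; _<_)
open import Data.Product using (_×_; ∃-syntax)
open import Data.Sum using (_⊎_)
open import Level using (0ℓ)
open import Relation.Binary.PropositionalEquality using (_≡_; _≢_)
open import Relation.Nullary using (¬_; does)
open import Relation.Unary as U using (Pred; Decidable)

-- The vertices are drawn from a finite stock of labels Fin n, not all of which
-- need be vertices.  Hence a subhypergraph, two vertex-disjoint hypergraphs and
-- their Hajós joins all live over the same n.  Decidability of E says that the
-- edge set is a finite set in the constructive sense.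
record Hypergraph (n : ℕ) : Set₁ where
  field
    V   : Subset n
    E   : Pred (Subset n) 0ℓ
    E?  : Decidable E
    E⊆V : ∀ {e} → E e → e ⊆ V
    2≤E : ∀ {e} → E e → 2 ≤ ∣ e ∣

open Hypergraph public

private
  variable
    n : ℕ

-- Colorings with the colors 0, …, k - 1.  The values of c outside V G are
-- irrelevant; taking them in ℕ rather than Fin k avoids asking for a color of
-- non-vertices, which would go wrong for k = 0.
record IsColoring (G : Hypergraph n) (k : ℕ) (c : Fin n → ℕ) : Set where
  field
    color<k : ∀ {x} → x ∈ V G → c x < k
    proper  : ∀ {e} → E G e → ∃[ x ] ∃[ y ] x ∈ e × y ∈ e × c x ≢ c y

Colorable : Hypergraph n → ℕ → Set
Colorable G k = ∃[ c ] IsColoring G k c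

-- The chromatic number as a functional relation: χ G m says χ(G) = m.
χ : Hypergraph n → ℕ → Set
χ G m = Colorable G m × (∀ j → Colorable G j → m ≤ j)

χ≤ : Hypergraph n → ℕ → Set
χ≤ G k = ∃[ m ] χ G m × m ≤ k

_≋_ : Hypergraph n → Hypergraph n → Set
H ≋ G = V H ≡ V G × E H U.≐ E G

_IsSubhypergraphOf_ : Hypergraph n → Hypergraph n → Set
H IsSubhypergraphOf G = V H ⊆ V G × E H U.⊆ E G

_IsProperSubhypergraphOf_ : Hypergraph n → Hypergraph n → Set
H IsProperSubhypergraphOf G = H IsSubhypergraphOf G × ¬ (H ≋ G)

[_+1]-Critical : ℕ → Hypergraph n → Set₁
[ k +1]-Critical G = χ G (suc k) × (∀ H → H IsProperSubhypergraphOf G → χ≤ H k)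

-- The image of a set of vertices when v is renamed to w.
rename : Fin n → Fin n → Subset n → Subset n
rename v w s = if does (v ∈? s) then (s - v) ∪ ⁅ w ⁆ else s

-- G is a Hajós join (G₁,v₁,e₁)Δ(G₂,v₂,e₂).  This is a relation because the new
-- vertex and the form of the new edge are not determined by the arguments.
record IsHajósJoin (G : Hypergraph n)
                   (G₁ : Hypergraph n) (v₁ : Fin n) (e₁ : Subset n)
                   (G₂ : Hypergraph n) (v₂ : Fin n) (e₂ : Subset n) : Set where
  field
    disjoint : Empty (V G₁ ∩ V G₂)
    e₁∈E₁    : E G₁ e₁
    e₂∈E₂    : E G₂ e₂
    v₁∈e₁    : v₁ ∈ e₁
    v₂∈e₂    : v₂ ∈ e₂

    v*       : Fin n
    v*-new   : v* ∉ V G₁ ∪ V G₂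

    e*       : Subset n
    e*-def   : e* ≡ (e₁ ∪ e₂) - v₁ - v₂ ⊎ e* ≡ ((e₁ ∪ e₂) - v₁ - v₂) ∪ ⁅ v* ⁆

    V-def    : V G ≡ ((V G₁ ∪ V G₂) - v₁ - v₂) ∪ ⁅ v* ⁆
    E-def    : E G U.≐ λ e →
                 (∃[ f ] E G₁ f × f ≢ e₁ × e ≡ rename v₁ v* f)
               ⊎ (∃[ f ] E G₂ f × f ≢ e₂ × e ≡ rename v₂ v* f)
               ⊎ e ≡ e*

{-# OPTIONS --safe #-}
module Submission where

-- For k ≥ 1, a hypergraph is (k+1)-critical iff it is not k-colorable, becomes
-- k-colorable when any single edge is deleted, and has no isolated vertex; these
-- conditions are transferred between G and G₁, G₂.  A coloring of the join
-- restricts to both components along the maps sending vᵢ to v*, and two colorings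
-- of the components that agree at v₁ and v₂ can be glued; agreement is achieved by
-- transposing two colors.  If Gᵢ is not k-colorable, every k-coloring of Gᵢ - eᵢ
-- is constant on eᵢ.  Hence e* cannot be properly colored when both G₁ and G₂ are
-- not k-colorable.  Conversely, a coloring c₁ that is not constant on e₁ glues with
-- c₂ to one that is not constant on e*, if c₂ is constant on e₂ or if k ≥ 3.

open import Data.Bool.Properties as Bool using ()
open import Data.Fin using (Fin; toℕ; fromℕ<; finToFun; funToFin)
open import Data.Fin.Properties using (any?; toℕ-fromℕ<; finToFun-funToFin)
  renaming (_≟_ to _≟ᶠ_)
open import Data.Fin.Subset using (Subset; _∈_; _∉_; _⊆_; _∪_; _-_; ⁅_⁆; ∣_∣; Empty)
open import Data.Fin.Subset.Properties
open import Data.Nat using (ℕ; zero; suc; _≤_; _<_; _^_; z≤n; s≤s; _≟_; _<?_)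
open import Data.Nat.Properties
  using (≤-refl; ≤-reflexive; ≤-trans; <-≤-trans; <⇒≤; <⇒≱; ≰⇒>; <⇒≢; m<n⇒m<1+n; m≤n⇒m≤1+n;
         m≤n⇒m⊓n≡m; m⊓n≤n)
open import Data.Product using (_×_; _,_; proj₁; proj₂; ∃-syntax)
open import Data.Sum using (_⊎_; inj₁; inj₂; [_,_]′)
open import Data.Vec using (_∷_; there)
open import Data.Vec.Properties using (≡-dec)
open import Data.Vec.Functional using (updateAt)
open import Data.Vec.Functional.Properties using (updateAt-updates; updateAt-minimal)
open import Function using (_∘_; id; const; case_of_)
open import Relation.Binary.Definitions using (DecidableEquality)
open import Relation.Binary.PropositionalEquality
  using (_≡_; _≢_; refl; sym; trans; cong; subst; subst₂; ≢-sym)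
open import Relation.Nullary using (¬_; Dec; yes; no; ¬?; _×-dec_; contradiction)
open import Relation.Nullary.Decidable using (map′; decidable-stable)
open import Relation.Unary as U using ()

open import Defs

private
  variable
    n k : ℕ
    G G₁ G₂ : Hypergraph n
    c c′ : Fin n → ℕ
    e e₁ e₂ f : Subset n
    v v₁ v₂ w x y : Fin n

-- Finite vertex sets and edges that carry two colors.

_≟ˢ_ : DecidableEquality (Subset n)
_≟ˢ_ = ≡-dec Bool._≟_

x∉p-x : ∀ (p : Subset n) x → x ∉ p - x
x∉p-x (s ∷ p) Fin.zero    ()
x∉p-x (s ∷ p) (Fin.suc x) (there x∈) = x∉p-x p x x∈

x∈p-y⁻ : ∀ (p : Subset n) → x ∈ p - y → x ∈ p × x ≢ y
x∈p-y⁻ {y = y} p x∈ = p─q⊆p p ⁅ y ⁆ x∈ , λ { refl → x∉p-x p y x∈ }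

other-element : 2 ≤ ∣ e ∣ → ∀ v → ∃[ x ] x ∈ e × x ≢ v
other-element {e = e} 2≤ v with any? (λ x → x ∈? e ×-dec ¬? (x ≟ᶠ v))
... | yes found = found
... | no  none  = contradiction 2≤
  (<⇒≱ (s≤s (≤-trans (p⊆q⇒∣p∣≤∣q∣ e⊆v) (≤-reflexive (∣⁅x⁆∣≡1 v)))))
  where
  e⊆v : e ⊆ ⁅ v ⁆
  e⊆v {x} x∈e with x ≟ᶠ v
  ... | yes refl = x∈⁅x⁆ v
  ... | no  x≢v  = contradiction (x , x∈e , x≢v) none

some-element : ∀ {n} {e : Subset n} → 2 ≤ ∣ e ∣ → ∃[ x ] x ∈ e
some-element {n} {e} 2≤ with nonempty? e
... | yes found = found
... | no  empty = contradiction
  (subst (2 ≤_) (trans (cong ∣_∣ (Empty-unique empty)) (∣⊥∣≡0 n)) 2≤) λ ()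

Bichromatic : (Fin n → ℕ) → Subset n → Set
Bichromatic c e = ∃[ x ] ∃[ y ] x ∈ e × y ∈ e × c x ≢ c y

bichromatic? : ∀ (c : Fin n → ℕ) e → Dec (Bichromatic c e)
bichromatic? c e = any? λ x → any? λ y → x ∈? e ×-dec y ∈? e ×-dec ¬? (c x ≟ c y)

Bichromatic-resp : (∀ {x} → x ∈ e → c x ≡ c′ x) → Bichromatic c e → Bichromatic c′ e
Bichromatic-resp eq (x , y , x∈e , y∈e , cx≢cy) =
  x , y , x∈e , y∈e , subst₂ _≢_ (eq x∈e) (eq y∈e) cx≢cy

monochromatic : ¬ Bichromatic c e → x ∈ e → y ∈ e → c x ≡ c y
monochromatic {c = c} {x = x} {y} ¬bi x∈e y∈e =
  decidable-stable (c x ≟ c y) λ cx≢cy → ¬bi (x , y , x∈e , y∈e , cx≢cy)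

-- Two different colors cannot both equal `a`. In the uses below, `a` is the color of `v₁` or of
-- `v*`.
bichromatic-from : Bichromatic c e → ∀ a → ∃[ x ] x ∈ e × c x ≢ a
bichromatic-from {c = c} (x , y , x∈e , y∈e , cx≢cy) a with c x ≟ a
... | no  cx≢a = x , x∈e , cx≢a
... | yes refl = y , y∈e , ≢-sym cx≢cy

-- Decidability of colorability and the chromatic number.

open IsColoring

Colorable-mono : ∀ {j} → k ≤ j → Colorable G k → Colorable G j
Colorable-mono k≤j (c , col) = c , record
  { color<k = λ x∈V → <-≤-trans (color<k col x∈V) k≤j ; proper = proper col }

-- Capping the colors at k makes the set of candidate colorings finite, without
-- disturbing the condition c x < k.
colorable? : ∀ (G : Hypergraph n) k → Dec (Colorable G k)
colorable? {n} G k = map′ to from (any? λ i → isColoring? (decode i))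
  where
  decode : Fin (suc k ^ n) → Fin n → ℕ
  decode i = toℕ ∘ finToFun {suc k} i

  isColoring? : ∀ c → Dec (IsColoring G k c)
  isColoring? c = map′
    (λ (bound , good) → record
      { color<k = λ {x} x∈V → decidable-stable (c x <? k) λ ≮k → bound (x , x∈V , ≮k)
      ; proper  = λ {e} Ee → decidable-stable (bichromatic? c e) λ ¬bi → good (e , Ee , ¬bi) })
    (λ col → (λ (x , x∈V , ≮k) → ≮k (color<k col x∈V)) , λ (e , Ee , ¬bi) → ¬bi (proper col Ee))
    (¬? (any? λ x → x ∈? V G ×-dec ¬? (c x <? k)) ×-dec
     ¬? (anySubset? λ e → E? G e ×-dec ¬? (bichromatic? c e)))

  to : ∃[ i ] IsColoring G k (decode i) → Colorable G k
  to (i , col) = decode i , col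

  from : Colorable G k → ∃[ i ] IsColoring G k (decode i)
  from (c , col) = funToFin cap , record
    { color<k = λ x∈V → subst (_< k) (agrees x∈V) (color<k col x∈V)
    ; proper  = λ Ee → Bichromatic-resp (agrees ∘ E⊆V G Ee) (proper col Ee) }
    where
    cap : Fin n → Fin (suc k)
    cap x = fromℕ< (s≤s (m⊓n≤n (c x) k))

    agrees : ∀ {x} → x ∈ V G → c x ≡ decode (funToFin cap) x
    agrees {x} x∈V = sym (trans (cong toℕ (finToFun-funToFin cap x))
      (trans (toℕ-fromℕ< _) (m≤n⇒m⊓n≡m (<⇒≤ (color<k col x∈V)))))

-- As `χ` asks for the least number of colors, the search descends from `k` until one color fewer no
-- longer suffices; by monotonicity no smaller number suffices either.
Colorable⇒χ≤ : ∀ k → Colorable G k → χ≤ G k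
Colorable⇒χ≤ zero    col = 0 , (col , λ _ _ → z≤n) , z≤n
Colorable⇒χ≤ {G = G} (suc k) col with colorable? G k
... | yes col′ = let m , χm , m≤k = Colorable⇒χ≤ k col′ in m , χm , m≤n⇒m≤1+n m≤k
... | no  ¬col = suc k
  , (col , λ j colⱼ → ≰⇒> λ j≤k → ¬col (Colorable-mono j≤k colⱼ))
  , ≤-refl

χ≤⇒Colorable : χ≤ G k → Colorable G k
χ≤⇒Colorable (m , (col , _) , m≤k) = Colorable-mono m≤k col

-- Edge deletion and criticality.

infixl 6 _∖_

_∖_ : Hypergraph n → Subset n → Hypergraph n
G ∖ e = record
  { V   = V G
  ; E   = λ f → E G f × f ≢ e
  ; E?  = λ f → E? G f ×-dec ¬? (f ≟ˢ e)
  ; E⊆V = E⊆V G ∘ proj₁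
  ; 2≤E = 2≤E G ∘ proj₁
  }

restore-edge : IsColoring (G ∖ e) k c → Bichromatic c e → IsColoring G k c
restore-edge {e = e} col bi = record
  { color<k = color<k col
  ; proper  = λ {f} Ef → case f ≟ˢ e of λ where
      (yes refl) → bi
      (no  f≢e)  → proper col (Ef , f≢e) }

record EdgeCritical (k : ℕ) (G : Hypergraph n) : Set where
  field
    ¬colorable : ¬ Colorable G k
    deletion   : E G e → Colorable (G ∖ e) k
    noIsolated : x ∈ V G → ∃[ e ] E G e × x ∈ e

open EdgeCritical

forced-monochromatic : ¬ Colorable G k → IsColoring (G ∖ e) k c → x ∈ e → y ∈ e → c x ≡ c y
forced-monochromatic {c = c} ¬col col =
  monochromatic λ bi → ¬col (c , restore-edge col bi)

_[_↦_] : ∀ {A : Set} → (Fin n → A) → Fin n → A → Fin n → A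
c [ v ↦ a ] = updateAt c v (const a)

↦-updates : ∀ {A : Set} (c : Fin n → A) v {a} → (c [ v ↦ a ]) v ≡ a
↦-updates c v = updateAt-updates v c

↦-minimal : ∀ {A : Set} (c : Fin n → A) {a} → x ≢ v → (c [ v ↦ a ]) x ≡ c x
↦-minimal {x = x} {v = v} c x≢v = updateAt-minimal x v c x≢v

recolor-bound : ∀ {a} → (∀ {x} → x ∈ V G → c x < k) → a < k →
                ∀ {x} → x ∈ V G → (c [ v ↦ a ]) x < k
recolor-bound {c = c} {v = v} bound a<k {x} x∈V with x ≟ᶠ v
... | yes refl = subst (_< _) (sym (↦-updates c v)) a<k
... | no  x≢v  = subst (_< _) (sym (↦-minimal c x≢v)) (bound x∈V)

recolor-avoids : ∀ {a} → v ∉ f → Bichromatic c f → Bichromatic (c [ v ↦ a ]) f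
recolor-avoids {c = c} v∉f = Bichromatic-resp λ x∈f → sym (↦-minimal c λ { refl → v∉f x∈f })

recolor-contains : ∀ {a} → v ∈ f → y ∈ f → y ≢ v → c y ≢ a → Bichromatic (c [ v ↦ a ]) f
recolor-contains {v = v} {y = y} {c = c} v∈f y∈f y≢v cy≢a =
  y , v , y∈f , v∈f , subst₂ _≢_ (sym (↦-minimal c y≢v)) (sym (↦-updates c v)) cy≢a

-- A vertex `u` of `e` receives the fresh color `k`. An edge through `u` has a further vertex,
-- colored below `k`; an edge missing `u` differs from `e` and keeps its two colors.
Colorable-suc : E G e → Colorable (G ∖ e) k → Colorable G (suc k)
Colorable-suc {G = G} {e = e} {k = k} Ee (c , col) with u , u∈e ← some-element (2≤E G Ee) =
  c [ u ↦ k ] , record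
  { color<k = recolor-bound {G = G} (m<n⇒m<1+n ∘ color<k col) ≤-refl
  ; proper  = good u u∈e }
  where
  good : ∀ u → u ∈ e → ∀ {f} → E G f → Bichromatic (c [ u ↦ k ]) f
  good u u∈e {f} Ef with u ∈? f
  ... | yes u∈f = let y , y∈f , y≢u = other-element (2≤E G Ef) u in
                  recolor-contains u∈f y∈f y≢u (<⇒≢ (color<k col (E⊆V G Ef y∈f)))
  ... | no  u∉f = recolor-avoids u∉f (proper col (Ef , λ { refl → u∉f u∈e }))

-- If a proper subhypergraph misses an edge, it inherits the coloring obtained by deleting that
-- edge. If it had all edges, it would also have all vertices, as none is isolated, and would not be
-- proper.
EdgeCritical⇒Critical : EdgeCritical k G → [ k +1]-Critical G
EdgeCritical⇒Critical {k = k} {G = G} crit = (colorable , minimal) , sub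
  where
  colorable : Colorable G (suc k)
  colorable with anySubset? (E? G)
  ... | yes (e , Ee) = Colorable-suc Ee (deletion crit Ee)
  -- Without edges the single color 0 suffices, and it lies below `suc k` even for `k` = 0.
  ... | no  none     = const 0 , record
    { color<k = λ _ → s≤s z≤n ; proper = λ Ee → contradiction (_ , Ee) none }

  minimal : ∀ j → Colorable G j → suc k ≤ j
  minimal j col = ≰⇒> λ j≤k → ¬colorable crit (Colorable-mono j≤k col)

  sub : ∀ H → H IsProperSubhypergraphOf G → χ≤ H k
  sub H ((VH⊆VG , EH⊆EG) , H≄G) with anySubset? (λ e → E? G e ×-dec ¬? (E? H e))
  ... | yes (e , Ee , ¬EHe) = let c , col = deletion crit Ee in
    Colorable⇒χ≤ k (c , record
      { color<k = color<k col ∘ VH⊆VG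
      ; proper  = λ Ef → proper col (EH⊆EG Ef , λ { refl → ¬EHe Ef }) })
  ... | no none = contradiction (⊆-antisym VH⊆VG VG⊆VH , (λ {_} → EH⊆EG) , λ {_} → EG⊆EH) H≄G
    where
    EG⊆EH : E G U.⊆ E H
    EG⊆EH {e} Ee = decidable-stable (E? H e) λ ¬EHe → none (e , Ee , ¬EHe)

    VG⊆VH : V G ⊆ V H
    VG⊆VH x∈V = let _ , Ee , x∈e = noIsolated crit x∈V in E⊆V H (EG⊆EH Ee) x∈e

-- An isolated vertex could be removed, the rest colored by criticality, and the vertex put back
-- with color 0, which is available because `1 ≤ k`. For `k` = 0 a single vertex without edges is
-- critical although isolated.
Critical⇒EdgeCritical : 1 ≤ k → [ k +1]-Critical G → EdgeCritical k G
Critical⇒EdgeCritical {k = k} {G = G} 1≤k ((_ , minimal) , sub) = record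
  { ¬colorable = ¬col
  ; deletion   = λ {e} Ee → χ≤⇒Colorable (sub (G ∖ e)
      ((id , proj₁) , λ (_ , _ , G⊆) → proj₂ (G⊆ Ee) refl))
  ; noIsolated = covered }
  where
  ¬col : ¬ Colorable G k
  ¬col col = <⇒≱ ≤-refl (minimal k col)

  covered : ∀ {x} → x ∈ V G → ∃[ e ] E G e × x ∈ e
  covered {x} x∈V with anySubset? (λ e → E? G e ×-dec x ∈? e)
  ... | yes found = found
  ... | no  none  = contradiction (γ [ x ↦ 0 ] , record
    { color<k = bound
    ; proper  = λ Ee → recolor-avoids (λ x∈e → none (_ , Ee , x∈e)) (proper col Ee) }) ¬col
    where
    G-x : Hypergraph _
    G-x = record
      { V   = V G - x
      ; E   = E G
      ; E?  = E? G
      ; E⊆V = λ Ee y∈e → x∈p∧x≢y⇒x∈p-y (E⊆V G Ee y∈e) λ { refl → none (_ , Ee , y∈e) }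
      ; 2≤E = 2≤E G }

    G-x-colorable : Colorable G-x k
    G-x-colorable = χ≤⇒Colorable (sub G-x ((p─q⊆p (V G) ⁅ x ⁆ , id) ,
      λ (V≡ , _) → x∉p-x (V G) x (subst (x ∈_) (sym V≡) x∈V)))

    γ = proj₁ G-x-colorable
    col = proj₂ G-x-colorable

    bound : ∀ {y} → y ∈ V G → (γ [ x ↦ 0 ]) y < k
    bound {y} y∈V with y ≟ᶠ x
    ... | yes refl = subst (_< k) (sym (↦-updates γ x)) 1≤k
    ... | no  y≢x  = subst (_< k) (sym (↦-minimal γ y≢x)) (color<k col (x∈p∧x≢y⇒x∈p-y y∈V y≢x))

-- Spare colors and transpositions of colors.

another-color : 2 ≤ k → ∀ a → ∃[ d ] d < k × a ≢ d
another-color (s≤s (s≤s _)) zero    = 1 , s≤s (s≤s z≤n) , λ ()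
another-color (s≤s (s≤s _)) (suc a) = 0 , s≤s z≤n , λ ()

third-color : 3 ≤ k → ∀ a b → ∃[ d ] d < k × a ≢ d × b ≢ d
third-color (s≤s (s≤s (s≤s _))) zero          zero          = 1 , s≤s (s≤s z≤n) , (λ ()) , λ ()
third-color (s≤s (s≤s (s≤s _))) zero          (suc zero)    = 2 , s≤s (s≤s (s≤s z≤n)) , (λ ()) , λ ()
third-color (s≤s (s≤s (s≤s _))) zero          (suc (suc b)) = 1 , s≤s (s≤s z≤n) , (λ ()) , λ ()
third-color (s≤s (s≤s (s≤s _))) (suc zero)    zero          = 2 , s≤s (s≤s (s≤s z≤n)) , (λ ()) , λ ()
third-color (s≤s (s≤s (s≤s _))) (suc (suc a)) zero          = 1 , s≤s (s≤s z≤n) , (λ ()) , λ ()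
third-color (s≤s (s≤s (s≤s _))) (suc a)       (suc b)       = 0 , s≤s z≤n , (λ ()) , λ ()

-- If `e` were the only edge through `v`, then in a coloring without `e` the color of `v` could be
-- changed freely. Making it differ from that of another vertex of `e` would color all of `G`.
another-edge : 2 ≤ k → EdgeCritical k G → E G e → v ∈ e → ∃[ f ] E G f × f ≢ e × v ∈ f
another-edge {G = G} {e = e} {v = v} 2≤k crit Ee v∈e
  with anySubset? (λ f → E? G f ×-dec ¬? (f ≟ˢ e) ×-dec v ∈? f)
... | yes found = found
... | no  none  = contradiction (γ [ v ↦ d ] , restore-edge
    (record { color<k = recolor-bound {G = G} (color<k col) d<k
            ; proper  = λ (Ef , f≢e) → recolor-avoids (λ v∈f → none (_ , Ef , f≢e , v∈f))
                                                      (proper col (Ef , f≢e)) })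
    (recolor-contains v∈e x∈e x≢v cx≢d)) (¬colorable crit)
  where
  γ = proj₁ (deletion crit Ee)
  col = proj₂ (deletion crit Ee)
  other = other-element (2≤E G Ee) v
  x∈e = proj₁ (proj₂ other)
  x≢v = proj₂ (proj₂ other)
  new = another-color 2≤k (γ (proj₁ other))
  d = proj₁ new
  d<k = proj₁ (proj₂ new)
  cx≢d = proj₂ (proj₂ new)

transpose : ℕ → ℕ → ℕ → ℕ
transpose a b i with i ≟ a | i ≟ b
... | yes _ | _     = b
... | no _  | yes _ = a
... | no _  | no _  = i

transpose-first : ∀ a b → transpose a b a ≡ b
transpose-first a b with a ≟ a
... | yes _  = refl
... | no a≢a = contradiction refl a≢a

transpose-second : ∀ a b → transpose a b b ≡ a
transpose-second a b with b ≟ a | b ≟ b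
... | yes b≡a | _     = b≡a
... | no _    | yes _ = refl
... | no _    | no b≢b = contradiction refl b≢b

transpose-fixes : ∀ {a b i} → i ≢ a → i ≢ b → transpose a b i ≡ i
transpose-fixes {a} {b} {i} i≢a i≢b with i ≟ a | i ≟ b
... | yes i≡a | _       = contradiction i≡a i≢a
... | no _    | yes i≡b = contradiction i≡b i≢b
... | no _    | no _    = refl

transpose-involutive : ∀ a b i → transpose a b (transpose a b i) ≡ i
transpose-involutive a b i = lemma (i ≟ a) (i ≟ b)
  where
  lemma : Dec (i ≡ a) → Dec (i ≡ b) → transpose a b (transpose a b i) ≡ i
  lemma (yes refl) _          = trans (cong (transpose a b) (transpose-first a b)) (transpose-second a b)
  lemma (no _)     (yes refl) = trans (cong (transpose a b) (transpose-second a b)) (transpose-first a b)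
  lemma (no i≢a)   (no i≢b)   = trans (cong (transpose a b) (transpose-fixes i≢a i≢b)) (transpose-fixes i≢a i≢b)

transpose-injective : ∀ a b {i j} → transpose a b i ≡ transpose a b j → i ≡ j
transpose-injective a b {i} {j} eq =
  trans (sym (transpose-involutive a b i)) (trans (cong (transpose a b) eq) (transpose-involutive a b j))

transpose-bound : ∀ {a b i} → a < k → b < k → i < k → transpose a b i < k
transpose-bound {a = a} {b} {i} a<k b<k i<k with i ≟ a | i ≟ b
... | yes _ | _     = b<k
... | no _  | yes _ = a<k
... | no _  | no _  = i<k

transpose-colors : ∀ {a b} → a < k → b < k → IsColoring G k c → IsColoring G k (transpose a b ∘ c)
transpose-colors a<k b<k col = record
  { color<k = transpose-bound a<k b<k ∘ color<k col
  ; proper  = λ Ee → let x , y , x∈e , y∈e , cx≢cy = proper col Ee in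
                     x , y , x∈e , y∈e , cx≢cy ∘ transpose-injective _ _ }

-- Exchanging `a` with the present color of `v` permutes the colors below `k`. This makes colorings
-- of the two components agree at the vertices to be identified.
color-as : ∀ {a} → a < k → v ∈ V G → IsColoring G k c → ∃[ c′ ] IsColoring G k c′ × a ≡ c′ v
color-as {v = v} {c = c} {a = a} a<k v∈V col =
  transpose (c v) a ∘ c , transpose-colors (color<k col v∈V) a<k col , sym (transpose-first (c v) a)

-- This is the only step that needs k ≥ 3: b is exchanged with a third color.
avoid-color : ∀ {b} → 3 ≤ k → b < k → b ≢ c v → ∀ y → IsColoring G k c →
              ∃[ c′ ] IsColoring G k c′ × c v ≡ c′ v × c′ y ≢ b
avoid-color {c = c} {v = v} {b = b} 3≤k b<k b≢cv y col with c y ≟ b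
... | no  cy≢b = c , col , refl , cy≢b
... | yes refl with d , d<k , b≢d , cv≢d ← third-color 3≤k b (c v) =
  transpose b d ∘ c , transpose-colors b<k d<k col ,
  sym (transpose-fixes (≢-sym b≢cv) cv≢d) ,
  λ eq → b≢d (trans (sym eq) (transpose-first b d))

-- Renaming a vertex.

relabel : Fin n → Fin n → Fin n → Fin n
relabel v w = id [ v ↦ w ]

-- Together with `∈-rename⁻` this identifies `rename v w f` as the image of `f` under `relabel v w`,
-- so that colorings can be pulled back along a map of vertices.
∈-rename⁺ : x ∈ f → relabel v w x ∈ rename v w f
∈-rename⁺ {x = x} {f = f} {v = v} {w = w} x∈f with x ≟ᶠ v
... | yes refl rewrite ↦-updates id x {w} with x ∈? f
...   | yes _  = x∈p∪q⁺ (inj₂ (x∈⁅x⁆ w))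
...   | no x∉f = contradiction x∈f x∉f
∈-rename⁺ {x = x} {f = f} {v = v} {w = w} x∈f | no x≢v rewrite ↦-minimal id {w} x≢v with v ∈? f
...   | yes _ = x∈p∪q⁺ (inj₁ (x∈p∧x≢y⇒x∈p-y x∈f x≢v))
...   | no _  = x∈f

∈-rename⁻ : y ∈ rename v w f → ∃[ x ] x ∈ f × relabel v w x ≡ y
∈-rename⁻ {y = y} {v = v} {w = w} {f = f} y∈ with v ∈? f
... | no v∉f = y , y∈ , ↦-minimal id λ { refl → v∉f y∈ }
... | yes v∈f with x∈p∪q⁻ (f - v) ⁅ w ⁆ y∈
...   | inj₁ y∈f-v = let y∈f , y≢v = x∈p-y⁻ f y∈f-v in y , y∈f , ↦-minimal id y≢v
...   | inj₂ y∈⁅w⁆ = v , v∈f , trans (↦-updates id v) (sym (x∈⁅y⁆⇒x≡y w y∈⁅w⁆))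

Bichromatic-rename⁺ : Bichromatic (c ∘ relabel v w) f → Bichromatic c (rename v w f)
Bichromatic-rename⁺ (x , y , x∈f , y∈f , neq) = _ , _ , ∈-rename⁺ x∈f , ∈-rename⁺ y∈f , neq

Bichromatic-rename⁻ : Bichromatic c (rename v w f) → Bichromatic (c ∘ relabel v w) f
Bichromatic-rename⁻ {c = c} {v = v} {w = w} {f = f} (x , y , x∈ , y∈ , cx≢cy) =
  let x′ , x′∈f , x′≡ = ∈-rename⁻ {v = v} {f = f} x∈
      y′ , y′∈f , y′≡ = ∈-rename⁻ {v = v} {f = f} y∈
  in x′ , y′ , x′∈f , y′∈f , subst₂ (λ a b → c a ≢ c b) (sym x′≡) (sym y′≡) cx≢cy

-- Only `v` and `w` itself are sent to `w`, so the map is injective once `w` is excluded.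
relabel-injective : x ≢ w → y ≢ w → relabel v w x ≡ relabel v w y → x ≡ y
relabel-injective {x = x} {w = w} {y = y} {v = v} x≢w y≢w eq with x ≟ᶠ v | y ≟ᶠ v
... | yes refl | yes refl = refl
... | yes refl | no y≢v   = contradiction (trans (sym (↦-minimal id y≢v)) (trans (sym eq) (↦-updates id v))) y≢w
... | no x≢v   | yes refl = contradiction (trans (sym (↦-minimal id x≢v)) (trans eq (↦-updates id v))) x≢w
... | no x≢v   | no y≢v   = trans (sym (↦-minimal id x≢v)) (trans eq (↦-minimal id y≢v))

rename-⊆ : w ∉ e → w ∉ f → rename v w e ≡ rename v w f → e ⊆ f
rename-⊆ {w = w} {e = e} {f = f} {v = v} w∉e w∉f eq {x} x∈e
  with x′ , x′∈f , x′≡ ← ∈-rename⁻ {v = v} {f = f} (subst (relabel v w x ∈_) eq (∈-rename⁺ {v = v} x∈e)) =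
  subst (_∈ f) (relabel-injective (λ { refl → w∉f x′∈f }) (λ { refl → w∉e x∈e }) x′≡) x′∈f

rename-injective : w ∉ e → w ∉ f → rename v w e ≡ rename v w f → e ≡ f
rename-injective w∉e w∉f eq = ⊆-antisym (rename-⊆ w∉e w∉f eq) (rename-⊆ w∉f w∉e (sym eq))

-- Symmetry and structure of Hajós joins.

-- With this, each fact is proved for the first component only. The witnesses `v*` and `e*` are
-- kept, so facts from both sides concern the same new vertex and edge.
IsHajósJoin-sym : ∀ {n : ℕ} {G G₁ G₂ : Hypergraph n} {v₁ v₂ : Fin n} {e₁ e₂ : Subset n} →
                  IsHajósJoin G G₁ v₁ e₁ G₂ v₂ e₂ → IsHajósJoin G G₂ v₂ e₂ G₁ v₁ e₁
IsHajósJoin-sym {G = G} {G₁} {G₂} {v₁} {v₂} {e₁} {e₂} J = record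
  { disjoint = subst Empty (∩-comm (V G₁) (V G₂)) disjoint
  ; e₁∈E₁    = e₂∈E₂
  ; e₂∈E₂    = e₁∈E₁
  ; v₁∈e₁    = v₂∈e₂
  ; v₂∈e₂    = v₁∈e₁
  ; v*       = v*
  ; v*-new   = subst (v* ∉_) (∪-comm (V G₁) (V G₂)) v*-new
  ; e*       = e*
  ; e*-def   = [ (λ eq → inj₁ (trans eq (swap e₁ e₂)))
               , (λ eq → inj₂ (trans eq (cong (_∪ ⁅ v* ⁆) (swap e₁ e₂)))) ]′ e*-def
  ; V-def    = trans V-def (cong (_∪ ⁅ v* ⁆) (swap (V G₁) (V G₂)))
  ; E-def    = (λ Ee → exchange (proj₁ E-def Ee)) , λ side → proj₂ E-def (exchange side)
  }
  where
  open IsHajósJoin J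

  swap : ∀ p q → (p ∪ q) - v₁ - v₂ ≡ (q ∪ p) - v₂ - v₁
  swap p q = trans (cong (λ r → r - v₁ - v₂) (∪-comm p q)) (p─x─y≡p─y─x (q ∪ p) v₁ v₂)

  exchange : ∀ {A B C : Set} → A ⊎ B ⊎ C → B ⊎ A ⊎ C
  exchange (inj₁ a)        = inj₂ (inj₁ a)
  exchange (inj₂ (inj₁ b)) = inj₁ b
  exchange (inj₂ (inj₂ c)) = inj₂ (inj₂ c)

module Join {n : ℕ} {G G₁ G₂ : Hypergraph n} {v₁ v₂ : Fin n} {e₁ e₂ : Subset n}
            (J : IsHajósJoin G G₁ v₁ e₁ G₂ v₂ e₂) where

  open IsHajósJoin J public

  ρ₁ ρ₂ : Fin n → Fin n
  ρ₁ = relabel v₁ v*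
  ρ₂ = relabel v₂ v*

  v₁∈V₁ : v₁ ∈ V G₁
  v₁∈V₁ = E⊆V G₁ e₁∈E₁ v₁∈e₁

  v₂∈V₂ : v₂ ∈ V G₂
  v₂∈V₂ = E⊆V G₂ e₂∈E₂ v₂∈e₂

  V₁∩V₂ : ∀ {x y} → x ∈ V G₁ → y ∈ V G₂ → x ≢ y
  V₁∩V₂ x∈V₁ x∈V₂ refl = disjoint (_ , x∈p∩q⁺ (x∈V₁ , x∈V₂))

  v*∉V₁ : v* ∉ V G₁
  v*∉V₁ = v*-new ∘ x∈p∪q⁺ ∘ inj₁

  v*∉V₂ : v* ∉ V G₂
  v*∉V₂ = v*-new ∘ x∈p∪q⁺ ∘ inj₂

  e*∈E : E G e*
  e*∈E = proj₂ E-def (inj₂ (inj₂ refl))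

  rename₁∈E : ∀ {f} → E G₁ f → f ≢ e₁ → E G (rename v₁ v* f)
  rename₁∈E Ef f≢e₁ = proj₂ E-def (inj₁ (_ , Ef , f≢e₁ , refl))

  v*∈V : v* ∈ V G
  v*∈V = subst (v* ∈_) (sym V-def) (x∈p∪q⁺ (inj₂ (x∈⁅x⁆ v*)))

  V₁⊆V : ∀ {x} → x ∈ V G₁ → x ≢ v₁ → x ∈ V G
  V₁⊆V x∈V₁ x≢v₁ = subst (_ ∈_) (sym V-def) (x∈p∪q⁺ (inj₁
    (x∈p∧x≢y⇒x∈p-y (x∈p∧x≢y⇒x∈p-y (x∈p∪q⁺ (inj₁ x∈V₁)) x≢v₁) (V₁∩V₂ x∈V₁ v₂∈V₂))))

  ρ₁∈V : ∀ {x} → x ∈ V G₁ → ρ₁ x ∈ V G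
  ρ₁∈V {x} x∈V₁ with x ≟ᶠ v₁
  ... | yes refl = subst (_∈ V G) (sym (↦-updates id v₁)) v*∈V
  ... | no x≢v₁  = subst (_∈ V G) (sym (↦-minimal id x≢v₁)) (V₁⊆V x∈V₁ x≢v₁)

  V-elim : ∀ {x} → x ∈ V G → (x ∈ V G₁ × x ≢ v₁) ⊎ (x ∈ V G₂ × x ≢ v₂) ⊎ x ≡ v*
  V-elim {x} x∈V with x∈p∪q⁻ _ ⁅ v* ⁆ (subst (x ∈_) V-def x∈V)
  ... | inj₂ x∈⁅v*⁆ = inj₂ (inj₂ (x∈⁅y⁆⇒x≡y v* x∈⁅v*⁆))
  ... | inj₁ x∈ with x∈p-y⁻ _ x∈
  ...   | x∈′ , x≢v₂ with x∈p-y⁻ _ x∈′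
  ...     | x∈V₁∪V₂ , x≢v₁ with x∈p∪q⁻ (V G₁) (V G₂) x∈V₁∪V₂
  ...       | inj₁ x∈V₁ = inj₁ (x∈V₁ , x≢v₁)
  ...       | inj₂ x∈V₂ = inj₂ (inj₁ (x∈V₂ , x≢v₂))

  -- The two forms of `e*` differ only in `v*`, and removing `v₂` takes nothing from `e₁`, as the
  -- components are disjoint.
  e₁⊆e* : ∀ {x} → x ∈ e₁ → x ≢ v₁ → x ∈ e*
  e₁⊆e* {x} x∈e₁ x≢v₁ =
    [ (λ eq → subst (x ∈_) (sym eq) x∈) , (λ eq → subst (x ∈_) (sym eq) (x∈p∪q⁺ (inj₁ x∈))) ]′ e*-def
    where
    x∈ : x ∈ (e₁ ∪ e₂) - v₁ - v₂
    x∈ = x∈p∧x≢y⇒x∈p-y (x∈p∧x≢y⇒x∈p-y (x∈p∪q⁺ (inj₁ x∈e₁)) x≢v₁) (V₁∩V₂ (E⊆V G₁ e₁∈E₁ x∈e₁) v₂∈V₂)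

  -- Allowing the case `x ≡ v*` treats both forms of the new edge at once; later arguments do not
  -- distinguish them.
  e*-elim : ∀ {x} → x ∈ e* → (x ∈ e₁ × x ≢ v₁) ⊎ (x ∈ e₂ × x ≢ v₂) ⊎ x ≡ v*
  e*-elim {x} x∈e* =
    [ (λ eq → old (subst (x ∈_) eq x∈e*))
    , (λ eq → [ old , (λ x∈ → inj₂ (inj₂ (x∈⁅y⁆⇒x≡y v* x∈))) ]′
                (x∈p∪q⁻ _ ⁅ v* ⁆ (subst (x ∈_) eq x∈e*))) ]′ e*-def
    where
    old : x ∈ (e₁ ∪ e₂) - v₁ - v₂ → (x ∈ e₁ × x ≢ v₁) ⊎ (x ∈ e₂ × x ≢ v₂) ⊎ x ≡ v*
    old x∈ with x∈p-y⁻ _ x∈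
    ... | x∈′ , x≢v₂ with x∈p-y⁻ _ x∈′
    ...   | x∈e₁∪e₂ , x≢v₁ with x∈p∪q⁻ e₁ e₂ x∈e₁∪e₂
    ...     | inj₁ x∈e₁ = inj₁ (x∈e₁ , x≢v₁)
    ...     | inj₂ x∈e₂ = inj₂ (inj₁ (x∈e₂ , x≢v₂))

  ∉rename₁ : ∀ {f x} → E G₁ f → x ∈ V G₂ → x ∉ rename v₁ v* f
  ∉rename₁ {f} {x} Ef x∈V₂ x∈ with ∈-rename⁻ {v = v₁} {f = f} x∈
  ... | y , y∈f , ρy≡x with y ≟ᶠ v₁
  ...   | yes refl = v*∉V₂ (subst (_∈ V G₂) (trans (sym ρy≡x) (↦-updates id v₁)) x∈V₂)
  ...   | no  y≢v₁ = V₁∩V₂ (E⊆V G₁ Ef y∈f) x∈V₂ (trans (sym (↦-minimal id y≢v₁)) ρy≡x)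

  rename₁-injective : ∀ {f g} → E G₁ f → E G₁ g → rename v₁ v* f ≡ rename v₁ v* g → f ≡ g
  rename₁-injective Ef Eg =
    rename-injective {v = v₁} (v*∉V₁ ∘ E⊆V G₁ Ef) (v*∉V₁ ∘ E⊆V G₁ Eg)

  -- An edge of `G₂` has a vertex other than `v₂`, which survives renaming and lies in no renamed
  -- edge of `G₁`. So deleting a renamed edge of one component leaves those of the other in place.
  rename₂≢rename₁ : ∀ {f g} → E G₁ f → E G₂ g → rename v₂ v* g ≢ rename v₁ v* f
  rename₂≢rename₁ {f} {g} Ef Eg eq with other-element (2≤E G₂ Eg) v₂
  ... | x , x∈g , x≢v₂ = ∉rename₁ Ef (E⊆V G₂ Eg x∈g)
    (subst₂ _∈_ (↦-minimal id x≢v₂) eq (∈-rename⁺ {v = v₂} x∈g))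

  -- `H` stands for the join or the join with one edge deleted. Among the edges of `G₁` only `e₁`
  -- has no renamed copy in the join, so it needs a separate assumption, which is void when `f` is
  -- `e₁`.
  restrict : ∀ {k c f} (H : Hypergraph n) → V G ⊆ V H →
             (∀ {g} → E G₁ g → g ≢ e₁ → g ≢ f → E H (rename v₁ v* g)) →
             (e₁ ≢ f → Bichromatic (c ∘ ρ₁) e₁) →
             IsColoring H k c → IsColoring (G₁ ∖ f) k (c ∘ ρ₁)
  restrict {c = c} {f} H V⊆ kept e₁-good col = record
    { color<k = color<k col ∘ V⊆ ∘ ρ₁∈V
    ; proper  = good }
    where
    good : ∀ {g} → E G₁ g × g ≢ f → Bichromatic (c ∘ ρ₁) g
    good {g} (Eg , g≢f) with g ≟ˢ e₁
    ... | yes refl = e₁-good g≢f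
    ... | no g≢e₁  = Bichromatic-rename⁻ {v = v₁} (proper col (kept Eg g≢e₁ g≢f))

  -- Some vertex of `e*` has a color other than that of `v*`. It cannot come from `e₂`, where every
  -- color is that of `v*`, so it lies in `e₁` and differs in color from `v₁`.
  e*-bichromatic⁻ : ∀ {c : Fin n → ℕ} → Bichromatic c e* →
                    (∀ {x} → x ∈ e₂ → c (ρ₂ x) ≡ c (ρ₂ v₂)) → Bichromatic (c ∘ ρ₁) e₁
  e*-bichromatic⁻ {c} bi mono₂ with bichromatic-from bi (c v*)
  ... | x , x∈e* , cx≢cv* with e*-elim x∈e*
  ...   | inj₁ (x∈e₁ , x≢v₁) = x , v₁ , x∈e₁ , v₁∈e₁ ,
          subst₂ (λ a b → c a ≢ c b) (sym (↦-minimal id x≢v₁)) (sym (↦-updates id v₁)) cx≢cv*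
  ...   | inj₂ (inj₁ (x∈e₂ , x≢v₂)) = contradiction
          (subst₂ (λ a b → c a ≡ c b) (↦-minimal id x≢v₂) (↦-updates id v₂) (mono₂ x∈e₂)) cx≢cv*
  ...   | inj₂ (inj₂ refl) = contradiction refl cx≢cv*

  restrict-monochromatic : ∀ {k c x} (H : Hypergraph n) → V G ⊆ V H →
    (∀ {g} → E G₁ g → g ≢ e₁ → E H (rename v₁ v* g)) → ¬ Colorable G₁ k →
    IsColoring H k c → x ∈ e₁ → c (ρ₁ x) ≡ c (ρ₁ v₁)
  restrict-monochromatic {c = c} H V⊆ kept ¬col₁ col x∈e₁ = forced-monochromatic {c = c ∘ ρ₁} ¬col₁
    (restrict H V⊆ (λ Eg g≢e₁ _ → kept Eg g≢e₁) (contradiction refl) col) x∈e₁ v₁∈e₁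

-- Gluing colorings, and transferring criticality in both directions.

module JoinCriticality {n : ℕ} {G G₁ G₂ : Hypergraph n} {v₁ v₂ : Fin n} {e₁ e₂ : Subset n}
                       (J : IsHajósJoin G G₁ v₁ e₁ G₂ v₂ e₂) where

  open Join J
  private module J′ = Join (IsHajósJoin-sym J)

  -- Only edges that survive in `H` have to be properly colored, so one statement serves the join
  -- and its edge deletions. The witnesses for `e*` avoid `v₁` and `v₂` and hence lie in either form
  -- of `e*`.
  glue : ∀ {k c₁ c₂} (H : Hypergraph n) → E H U.⊆ E G →
         (∀ {x} → x ∈ V G₁ → c₁ x < k) → (∀ {x} → x ∈ V G₂ → c₂ x < k) → c₁ v₁ ≡ c₂ v₂ →
         (∀ {f} → E G₁ f → f ≢ e₁ → E H (rename v₁ v* f) → Bichromatic c₁ f) →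
         (∀ {f} → E G₂ f → f ≢ e₂ → E H (rename v₂ v* f) → Bichromatic c₂ f) →
         (E H e* → ∃[ x ] ∃[ y ] (x ∈ e₁ × x ≢ v₁) × (y ∈ e₂ × y ≢ v₂) × c₁ x ≢ c₂ y) →
         Colorable H k
  glue {k} {c₁} {c₂} H H⊆G bound₁ bound₂ match good₁ good₂ good* = γ , record
    { color<k = λ {x} _ → bound x ; proper = good }
    where
    γ : Fin n → ℕ
    γ x with x ∈? V G₁ | x ∈? V G₂
    ... | yes _ | _     = c₁ x
    ... | no _  | yes _ = c₂ x
    -- This case covers `v*`, which gets the common color of `v₁` and `v₂`; for all other labels it
    -- is a default below `k`.
    ... | no _  | no _  = c₁ v₁

    bound : ∀ x → γ x < k
    bound x with x ∈? V G₁ | x ∈? V G₂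
    ... | yes x∈V₁ | _        = bound₁ x∈V₁
    ... | no _     | yes x∈V₂ = bound₂ x∈V₂
    ... | no _     | no _     = bound₁ v₁∈V₁

    γ-V₁ : ∀ {x} → x ∈ V G₁ → γ x ≡ c₁ x
    γ-V₁ {x} x∈V₁ with x ∈? V G₁ | x ∈? V G₂
    ... | yes _    | _ = refl
    ... | no x∉V₁  | _ = contradiction x∈V₁ x∉V₁

    γ-V₂ : ∀ {x} → x ∈ V G₂ → γ x ≡ c₂ x
    γ-V₂ {x} x∈V₂ with x ∈? V G₁ | x ∈? V G₂
    ... | yes x∈V₁ | _       = contradiction refl (V₁∩V₂ x∈V₁ x∈V₂)
    ... | no _     | yes _   = refl
    ... | no _     | no x∉V₂ = contradiction x∈V₂ x∉V₂

    γ-v* : γ v* ≡ c₁ v₁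
    γ-v* with v* ∈? V G₁ | v* ∈? V G₂
    ... | yes v*∈V₁ | _         = contradiction v*∈V₁ v*∉V₁
    ... | no _      | yes v*∈V₂ = contradiction v*∈V₂ v*∉V₂
    ... | no _      | no _      = refl

    γ-ρ₁ : ∀ {x} → x ∈ V G₁ → c₁ x ≡ γ (ρ₁ x)
    γ-ρ₁ {x} x∈V₁ with x ≟ᶠ v₁
    ... | yes refl = sym (trans (cong γ (↦-updates id v₁)) γ-v*)
    ... | no x≢v₁  = sym (trans (cong γ (↦-minimal id x≢v₁)) (γ-V₁ x∈V₁))

    γ-ρ₂ : ∀ {x} → x ∈ V G₂ → c₂ x ≡ γ (ρ₂ x)
    γ-ρ₂ {x} x∈V₂ with x ≟ᶠ v₂
    ... | yes refl = sym (trans (cong γ (↦-updates id v₂)) (trans γ-v* match))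
    ... | no x≢v₂  = sym (trans (cong γ (↦-minimal id x≢v₂)) (γ-V₂ x∈V₂))

    good : ∀ {e} → E H e → Bichromatic γ e
    good Ee with proj₁ E-def (H⊆G Ee)
    ... | inj₁ (f , Ef , f≢e₁ , refl) = Bichromatic-rename⁺ {v = v₁}
          (Bichromatic-resp (γ-ρ₁ ∘ E⊆V G₁ Ef) (good₁ Ef f≢e₁ Ee))
    ... | inj₂ (inj₁ (f , Ef , f≢e₂ , refl)) = Bichromatic-rename⁺ {v = v₂}
          (Bichromatic-resp (γ-ρ₂ ∘ E⊆V G₂ Ef) (good₂ Ef f≢e₂ Ee))
    ... | inj₂ (inj₂ refl) with good* Ee
    ...   | x , y , (x∈e₁ , x≢v₁) , (y∈e₂ , y≢v₂) , c₁x≢c₂y =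
          x , y , e₁⊆e* x∈e₁ x≢v₁ , J′.e₁⊆e* y∈e₂ y≢v₂ ,
          subst₂ _≢_ (sym (γ-V₁ (E⊆V G₁ e₁∈E₁ x∈e₁))) (sym (γ-V₂ (E⊆V G₂ e₂∈E₂ y∈e₂))) c₁x≢c₂y

  -- The coloring is constant on `e₂`, so the two colors on `e*` make `e₁` bichromatic, and its
  -- restriction would color all of `G₁`.
  join-¬colorable : ∀ {k} → ¬ Colorable G₁ k → ¬ Colorable G₂ k → ¬ Colorable G k
  join-¬colorable ¬col₁ ¬col₂ (c , col) = ¬col₁ (c ∘ ρ₁ , restore-edge
    (restrict G id (λ Eg g≢e₁ _ → rename₁∈E Eg g≢e₁) (contradiction refl) col)
    (e*-bichromatic⁻ (proper col e*∈E)
      (J′.restrict-monochromatic G id J′.rename₁∈E ¬col₂ col)))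

  -- A coloring of `G₁` without `f` still has a vertex of `e₁` colored unlike `v₁`, while one of
  -- `G₂` without `e₂` is constant on `e₂`. Once they agree at the identified vertex, `e*` receives
  -- two colors.
  join-deletion₁ : ∀ {k f} → EdgeCritical k G₁ → EdgeCritical k G₂ → E G₁ f → f ≢ e₁ →
                   Colorable (G ∖ rename v₁ v* f) k
  join-deletion₁ {f = f} crit₁ crit₂ Ef f≢e₁
    with c₁ , col₁ ← deletion crit₁ Ef | c , col ← deletion crit₂ e₂∈E₂
    with c₂ , col₂ , match ← color-as (color<k col₁ v₁∈V₁) v₂∈V₂ col
    with x , x∈e₁ , c₁x≢c₁v₁ ← bichromatic-from (proper col₁ (e₁∈E₁ , ≢-sym f≢e₁)) (c₁ v₁)
       | y , y∈e₂ , y≢v₂ ← other-element (2≤E G₂ e₂∈E₂) v₂ =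
    glue (G ∖ rename v₁ v* f) proj₁ (color<k col₁) (color<k col₂) match
      (λ Eg _ (_ , g≢f) → proper col₁ (Eg , λ { refl → g≢f refl }))
      (λ Eg g≢e₂ _ → proper col₂ (Eg , g≢e₂))
      (λ _ → x , y , (x∈e₁ , λ { refl → c₁x≢c₁v₁ refl }) , (y∈e₂ , y≢v₂) ,
        subst (c₁ x ≢_) (trans match (forced-monochromatic (¬colorable crit₂) col₂ v₂∈e₂ y∈e₂)) c₁x≢c₁v₁)

  join-deletion* : ∀ {k} → EdgeCritical k G₁ → EdgeCritical k G₂ → Colorable (G ∖ e*) k
  join-deletion* crit₁ crit₂
    with c₁ , col₁ ← deletion crit₁ e₁∈E₁ | c , col ← deletion crit₂ e₂∈E₂
    with c₂ , col₂ , match ← color-as (color<k col₁ v₁∈V₁) v₂∈V₂ col =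
    glue (G ∖ e*) proj₁ (color<k col₁) (color<k col₂) match
      (λ Eg g≢e₁ _ → proper col₁ (Eg , g≢e₁))
      (λ Eg g≢e₂ _ → proper col₂ (Eg , g≢e₂))
      (λ (_ , e*≢e*) → contradiction refl e*≢e*)

  join-noIsolated₁ : ∀ {k x} → EdgeCritical k G₁ → x ∈ V G₁ → x ≢ v₁ → ∃[ e ] E G e × x ∈ e
  join-noIsolated₁ crit₁ x∈V₁ x≢v₁ with noIsolated crit₁ x∈V₁
  ... | f , Ef , x∈f with f ≟ˢ e₁
  ...   | yes refl = e* , e*∈E , e₁⊆e* x∈f x≢v₁
  ...   | no f≢e₁  = _ , rename₁∈E Ef f≢e₁ ,
          subst (_∈ rename v₁ v* f) (↦-minimal id x≢v₁) (∈-rename⁺ {v = v₁} x∈f)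

  -- The edge `e*` may omit `v*`, so the covering edge is a renamed edge of `G₁` through `v₁` other
  -- than `e₁`.
  join-noIsolated* : ∀ {k} → 2 ≤ k → EdgeCritical k G₁ → ∃[ e ] E G e × v* ∈ e
  join-noIsolated* 2≤k crit₁ with another-edge 2≤k crit₁ e₁∈E₁ v₁∈e₁
  ... | f , Ef , f≢e₁ , v₁∈f = _ , rename₁∈E Ef f≢e₁ ,
        subst (_∈ rename v₁ v* f) (↦-updates id v₁) (∈-rename⁺ {v = v₁} v₁∈f)

  -- Renamed edges of `G₂` avoid `V G₁`. Hence a vertex other than `v₁` is covered by `e*`, and then
  -- by `e₁`, or by a renamed edge of `G₁`, whose original already contains it.
  component-noIsolated : (∀ {x} → x ∈ V G → ∃[ e ] E G e × x ∈ e) →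
                  ∀ {x} → x ∈ V G₁ → ∃[ e ] E G₁ e × x ∈ e
  component-noIsolated cov {x} x∈V₁ with x ≟ᶠ v₁
  ... | yes refl = e₁ , e₁∈E₁ , v₁∈e₁
  ... | no x≢v₁ with cov (V₁⊆V x∈V₁ x≢v₁)
  ...   | e , Ee , x∈e with proj₁ E-def Ee
  ...     | inj₂ (inj₂ refl) with e*-elim x∈e
  ...       | inj₁ (x∈e₁ , _)        = e₁ , e₁∈E₁ , x∈e₁
  ...       | inj₂ (inj₁ (x∈e₂ , _)) = contradiction refl (V₁∩V₂ x∈V₁ (E⊆V G₂ e₂∈E₂ x∈e₂))
  ...       | inj₂ (inj₂ refl)       = contradiction x∈V₁ v*∉V₁
  component-noIsolated cov {x} x∈V₁ | no x≢v₁ | e , Ee , x∈e | inj₁ (f , Ef , _ , refl)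
    with ∈-rename⁻ {v = v₁} {f = f} x∈e
  ... | y , y∈f , ρy≡x = f , Ef , subst (_∈ f)
    (relabel-injective {v = v₁} (λ { refl → v*∉V₁ (E⊆V G₁ Ef y∈f) }) (λ { refl → v*∉V₁ x∈V₁ })
      (trans ρy≡x (sym (↦-minimal id x≢v₁)))) y∈f
  component-noIsolated cov {x} x∈V₁ | no x≢v₁ | e , Ee , x∈e | inj₂ (inj₁ (f , Ef , _ , refl)) =
    contradiction x∈e (J′.∉rename₁ Ef x∈V₁)

  e*≢rename₁ : ∀ {f} → E G₁ f → e* ≢ rename v₁ v* f
  e*≢rename₁ Ef eq with other-element (2≤E G₂ e₂∈E₂) v₂
  ... | y , y∈e₂ , y≢v₂ =
    ∉rename₁ Ef (E⊆V G₂ e₂∈E₂ y∈e₂) (subst (y ∈_) eq (J′.e₁⊆e* y∈e₂ y≢v₂))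

  component-deletion* : ∀ {k} → EdgeCritical k G → Colorable (G₁ ∖ e₁) k
  component-deletion* crit with c , col ← deletion crit e*∈E =
    c ∘ ρ₁ , restrict (G ∖ e*) id
      (λ Eg g≢e₁ _ → rename₁∈E Eg g≢e₁ , e*≢rename₁ Eg ∘ sym) (contradiction refl) col

  -- Take `x` in `e₁` colored unlike `v₁` and `y` in `e₂` other than `v₂`. If `y` has the color of
  -- `x`, a color exchange that fixes the color of `v₂` separates them, and the glued coloring would
  -- color `G`.
  component-¬colorable : ∀ {k} → 3 ≤ k → ¬ Colorable G k → Colorable (G₂ ∖ e₂) k → ¬ Colorable G₁ k
  component-¬colorable 3≤k ¬col (c , col) (c₁ , col₁)
    with c₂ , col₂ , match ← color-as (color<k col₁ v₁∈V₁) v₂∈V₂ col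
    with x , x∈e₁ , c₁x≢c₁v₁ ← bichromatic-from (proper col₁ e₁∈E₁) (c₁ v₁)
       | y , y∈e₂ , y≢v₂ ← other-element (2≤E G₂ e₂∈E₂) v₂
    with c₃ , col₃ , c₂v₂≡c₃v₂ , c₃y≢c₁x ← avoid-color 3≤k (color<k col₁ (E⊆V G₁ e₁∈E₁ x∈e₁))
           (subst (c₁ x ≢_) match c₁x≢c₁v₁) y col₂ =
    ¬col (glue G id (color<k col₁) (color<k col₃) (trans match c₂v₂≡c₃v₂)
      (λ Eg _ _ → proper col₁ Eg)
      (λ Eg g≢e₂ _ → proper col₃ (Eg , g≢e₂))
      (λ _ → x , y , (x∈e₁ , λ { refl → c₁x≢c₁v₁ refl }) , (y∈e₂ , y≢v₂) , ≢-sym c₃y≢c₁x))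

  -- As `G₂` is not `k`-colorable, the coloring of the join is constant on `e₂`. The surviving edge
  -- `e*` then forces two colors on `e₁`, the one edge not inherited by renaming.
  component-deletion₁ : ∀ {k f} → EdgeCritical k G → ¬ Colorable G₂ k →
                        E G₁ f → f ≢ e₁ → Colorable (G₁ ∖ f) k
  component-deletion₁ {f = f} crit ¬col₂ Ef f≢e₁
    with c , col ← deletion crit (rename₁∈E Ef f≢e₁) =
    c ∘ ρ₁ , restrict (G ∖ rename v₁ v* f) id
      (λ Eg g≢e₁ g≢f → rename₁∈E Eg g≢e₁ , g≢f ∘ rename₁-injective Eg Ef)
      (λ _ → e*-bichromatic⁻ (proper col (e*∈E , e*≢rename₁ Ef))
        (J′.restrict-monochromatic (G ∖ rename v₁ v* f) id
          (λ Eg g≢e₂ → J′.rename₁∈E Eg g≢e₂ , rename₂≢rename₁ Ef Eg) ¬col₂ col))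
      col

-- The two implications for edge-criticality.

join-critical : IsHajósJoin G G₁ v₁ e₁ G₂ v₂ e₂ → 2 ≤ k →
                EdgeCritical k G₁ → EdgeCritical k G₂ → EdgeCritical k G
join-critical {G = G} {k = k} J 2≤k crit₁ crit₂ = record
  { ¬colorable = L.join-¬colorable (¬colorable crit₁) (¬colorable crit₂)
  ; deletion   = del
  ; noIsolated = cov }
  where
  module L = JoinCriticality J
  module R = JoinCriticality (IsHajósJoin-sym J)
  open Join J

  del : E G e → Colorable (G ∖ e) k
  del Ee with proj₁ E-def Ee
  ... | inj₁ (f , Ef , f≢e₁ , refl)        = L.join-deletion₁ crit₁ crit₂ Ef f≢e₁
  ... | inj₂ (inj₁ (f , Ef , f≢e₂ , refl)) = R.join-deletion₁ crit₂ crit₁ Ef f≢e₂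
  ... | inj₂ (inj₂ refl)                   = L.join-deletion* crit₁ crit₂

  cov : x ∈ V G → ∃[ e ] E G e × x ∈ e
  cov x∈V with V-elim x∈V
  ... | inj₁ (x∈V₁ , x≢v₁)        = L.join-noIsolated₁ crit₁ x∈V₁ x≢v₁
  ... | inj₂ (inj₁ (x∈V₂ , x≢v₂)) = R.join-noIsolated₁ crit₂ x∈V₂ x≢v₂
  ... | inj₂ (inj₂ refl)          = L.join-noIsolated* 2≤k crit₁

component-critical : IsHajósJoin G G₁ v₁ e₁ G₂ v₂ e₂ → 3 ≤ k →
                     EdgeCritical k G → EdgeCritical k G₁
component-critical {G₁ = G₁} {e₁ = e₁} {k = k} J 3≤k crit = record
  { ¬colorable = L.component-¬colorable 3≤k (¬colorable crit) (R.component-deletion* crit)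
  ; deletion   = del
  ; noIsolated = L.component-noIsolated (noIsolated crit) }
  where
  module L = JoinCriticality J
  module R = JoinCriticality (IsHajósJoin-sym J)

  del : E G₁ e → Colorable (G₁ ∖ e) k
  del {e = e} Ee with e ≟ˢ e₁
  ... | yes refl = L.component-deletion* crit
  -- That `G₂` is not `k`-colorable follows from the argument for `G₁` with the sides exchanged,
  -- using a coloring of `G₁` without `e₁`.
  ... | no e≢e₁  = L.component-deletion₁ crit
    (R.component-¬colorable 3≤k (¬colorable crit) (L.component-deletion* crit)) Ee e≢e₁

theorem9 : ∀ {n : ℕ} (G G₁ G₂ : Hypergraph n) (v₁ v₂ : Fin n) (e₁ e₂ : Subset n)
    → IsHajósJoin G G₁ v₁ e₁ G₂ v₂ e₂
    → ∀ (k : ℕ) → 2 ≤ k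
    → ([ k +1]-Critical G₁ × [ k +1]-Critical G₂ → [ k +1]-Critical G)
    × ([ k +1]-Critical G → 3 ≤ k → [ k +1]-Critical G₁ × [ k +1]-Critical G₂)
theorem9 G G₁ G₂ v₁ v₂ e₁ e₂ J k 2≤k =
  (λ (crit₁ , crit₂) → EdgeCritical⇒Critical (join-critical J 2≤k
    (Critical⇒EdgeCritical 1≤k crit₁) (Critical⇒EdgeCritical 1≤k crit₂))) ,
  λ crit 3≤k → let crit′ = Critical⇒EdgeCritical 1≤k crit in
    EdgeCritical⇒Critical (component-critical J 3≤k crit′) ,
    EdgeCritical⇒Critical (component-critical (IsHajósJoin-sym J) 3≤k crit′)
  where
  1≤k : 1 ≤ k
  1≤k = ≤-trans (s≤s z≤n) 2≤k
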